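{- 1. If the VC-dimension of a set system is less than or equal to $1$, then its additionality is less than or equal to $1$. So every set system with additionality $2$ has VC-dimension at least $2$. 2. The VC-dimension of every well-graded family with additionality $2$ is equal to $2$.
   Context: A set system $(X,\mathcal{F})$ is a finite set $X$ together with a nonempty family $\mathcal{F}$ of distinct subsets of $X$. Its one-inclusion graph $G_{\mathcal{F}}$ has a vertex $v_A$ for each $A\in\mathcal{F}$, with an edge (directed from $v_A$ to $v_B$, labelled $b$) whenever $B=A\cup\{b\}$ for some $b\in X\setminus A$. The system is a well-graded family if for all $A,B\in\mathcal{F}$ the distance between $v_A$ and $v_B$ in the underlying undirected graph of $G_{\mathcal{F}}$ equals $|A\triangle B|$ (infinite distance if there is no path). An element $x\in X$ is essential if there are $A,B\in\mathcal{F}$ with $x\in A$, $x\notin B$; $ess_{\mathcal{F}}(X)$ is the set of essential elements, and the additionality is $|\mathcal{F}|-|ess_{\mathcal{F}}(X)|$. The VC-dimension is the largest size of a set $Y\subseteq X$ such that $\{A\cap Y:A\in\mathcal{F}\}$ is the full power set of $Y$. -}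

module Defs where

open import Data.Bool.Properties using () renaming (_≟_ to _≟ᵇ_)
open import Data.Fin using (Fin)
open import Data.Fin.Subset using (Subset; inside; outside; _∈_; _∉_; _⊆_; _∩_; _∪_; _─_; ⁅_⁆; ∣_∣; ⊥)
open import Data.Fin.Subset.Properties using (_∈?_; _⊆?_; anySubset?; p∩q⊆q; ⊆-antisym; ⊆-min; ∩-zeroʳ; ∣⊥∣≡0)
open import Data.Integer using (ℤ; +_) renaming (_-_ to _-ᶻ_)
open import Data.List using (List; []; _∷_; length; map; filter; _++_)
open import Data.List.Extrema.Nat using (max; argmax-sel; xs≤max)
import Data.List.Membership.DecPropositional as DecMembership
open import Data.List.Membership.Propositional using (find; lose) renaming (_∈_ to _∈ₗ_)
open import Data.List.Membership.Propositional.Properties using (∈-map⁺; ∈-map⁻; ∈-++⁺ˡ; ∈-++⁺ʳ; ∈-filter⁺; ∈-filter⁻)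
open import Data.List.Relation.Unary.All using () renaming (lookup to All-lookup)
open import Data.List.Relation.Unary.Any using (here; any?)
open import Data.List.Relation.Unary.Unique.Propositional using (Unique)
open import Data.Nat using (ℕ; zero; suc; _≤_)
open import Data.Product using (∃; ∃₂; _×_; _,_)
open import Data.Sum using (inj₁; inj₂)
open import Data.Vec using ([]; _∷_; tabulate)
open import Data.Vec.Properties using (≡-dec)
open import Function using (id)
open import Relation.Binary using (DecidableEquality)
open import Relation.Binary.Construct.Closure.Symmetric using (SymClosure)
open import Relation.Binary.PropositionalEquality using (_≡_; _≢_; refl; sym; trans)
open import Relation.Nullary using (Dec; does; ¬?; contradiction)
open import Relation.Nullary.Decidable using (map′; _×-dec_; _→-dec_; decidable-stable)

private
  variable
    n : ℕ

-- The finite ground set X is Fin n; `distinct` makes the length of `family`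
-- the cardinality of the family of sets.
record SetSystem (n : ℕ) : Set where
  field
    family   : List (Subset n)
    distinct : Unique family
    nonempty : family ≢ []

open SetSystem public

infix 4 _∈ˢ_
_∈ˢ_ : Subset n → SetSystem n → Set
A ∈ˢ F = A ∈ₗ family F

card : SetSystem n → ℕ
card F = length (family F)

infixl 6 _△_
_△_ : Subset n → Subset n → Subset n
A △ B = (A ─ B) ∪ (B ─ A)

-- The one-inclusion graph has the members of F themselves as vertices;
-- `Edge F b A B` is the edge labelled b directed from A to B.
record Edge (F : SetSystem n) (b : Fin n) (A B : Subset n) : Set where
  field
    source∈  : A ∈ˢ F
    target∈  : B ∈ˢ F
    label∉   : b ∉ A
    target≡  : B ≡ A ∪ ⁅ b ⁆

Adjacent : SetSystem n → Subset n → Subset n → Set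
Adjacent F = SymClosure (λ A B → ∃ λ b → Edge F b A B)

-- `Walk F A B k`: a walk with k edges in the underlying undirected graph.
data Walk (F : SetSystem n) : Subset n → Subset n → ℕ → Set where
  stop : ∀ {A} → A ∈ˢ F → Walk F A A zero
  step : ∀ {A B C k} → Adjacent F A B → Walk F B C k → Walk F A C (suc k)

-- No d satisfies this when there is no walk, i.e. when the distance is infinite.
Distance : SetSystem n → Subset n → Subset n → ℕ → Set
Distance F A B d = Walk F A B d × (∀ k → Walk F A B k → d ≤ k)

WellGraded : SetSystem n → Set
WellGraded F = ∀ {A B} → A ∈ˢ F → B ∈ˢ F → Distance F A B ∣ A △ B ∣

Essential : SetSystem n → Fin n → Set
Essential F x = ∃₂ λ A B → A ∈ˢ F × B ∈ˢ F × x ∈ A × x ∉ B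

essential? : (F : SetSystem n) (x : Fin n) → Dec (Essential F x)
essential? F x = map′ to from (any? (x ∈?_) (family F) ×-dec any? (λ B → ¬? (x ∈? B)) (family F))
  where
  to = λ (p , q) → let (A , A∈F , x∈A) = find p
                       (B , B∈F , x∉B) = find q
                   in A , B , A∈F , B∈F , x∈A , x∉B
  from = λ (A , B , A∈F , B∈F , x∈A , x∉B) → lose A∈F x∈A , lose B∈F x∉B

ess : SetSystem n → Subset n
ess F = tabulate (λ x → does (essential? F x))

-- Integer-valued, since there can be more essential elements than sets.
additionality : SetSystem n → ℤ
additionality F = + card F -ᶻ + ∣ ess F ∣

trace : SetSystem n → Subset n → List (Subset n)
trace F Y = map (_∩ Y) (family F)

Shatters : SetSystem n → Subset n → Set
Shatters F Y = ∀ Z → (Z ∈ₗ trace F Y → Z ⊆ Y) × (Z ⊆ Y → Z ∈ₗ trace F Y)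

_≟ˢ_ : DecidableEquality (Subset n)
_≟ˢ_ = ≡-dec _≟ᵇ_

shatters? : (F : SetSystem n) (Y : Subset n) → Dec (Shatters F Y)
shatters? {n} F Y = map′ (λ ¬∃ Z → decidable-stable (agree? Z) (λ ¬p → ¬∃ (Z , ¬p)))
                         (λ s (Z , ¬p) → ¬p (s Z))
                         (¬? (anySubset? (λ Z → ¬? (agree? Z))))
  where
  open DecMembership (_≟ˢ_ {n}) using () renaming (_∈?_ to _∈ₗ?_)
  agree? : ∀ Z → Dec ((Z ∈ₗ trace F Y → Z ⊆ Y) × (Z ⊆ Y → Z ∈ₗ trace F Y))
  agree? Z = ((Z ∈ₗ? trace F Y) →-dec (Z ⊆? Y)) ×-dec ((Z ⊆? Y) →-dec (Z ∈ₗ? trace F Y))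

subsets : ∀ n → List (Subset n)
subsets zero    = [] ∷ []
subsets (suc n) = map (inside ∷_) (subsets n) ++ map (outside ∷_) (subsets n)

shatteredSizes : SetSystem n → List ℕ
shatteredSizes {n} F = map ∣_∣ (filter (shatters? F) (subsets n))

-- The default value 0 plays no role: the empty set is always shattered, so
-- the maximum is attained (see vcDim-attained and vcDim-upper).
vcDim : SetSystem n → ℕ
vcDim F = max 0 (shatteredSizes F)

∈-subsets : (Y : Subset n) → Y ∈ₗ subsets n
∈-subsets []            = here refl
∈-subsets (inside  ∷ Y) = ∈-++⁺ˡ (∈-map⁺ (inside ∷_) (∈-subsets Y))
∈-subsets {suc n} (outside ∷ Y) =
  ∈-++⁺ʳ (map (inside ∷_) (subsets n)) (∈-map⁺ (outside ∷_) (∈-subsets Y))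

vcDim-upper : (F : SetSystem n) (Y : Subset n) → Shatters F Y → ∣ Y ∣ ≤ vcDim F
vcDim-upper F Y s = All-lookup (xs≤max 0 (shatteredSizes F))
  (∈-map⁺ ∣_∣ (∈-filter⁺ (shatters? F) (∈-subsets Y) s))

shatters-⊥ : (F : SetSystem n) → Shatters F ⊥
shatters-⊥ F Z = to , from
  where
  to : Z ∈ₗ trace F ⊥ → Z ⊆ ⊥
  to Z∈ with (A , _ , refl) ← ∈-map⁻ (_∩ ⊥) Z∈ = p∩q⊆q A ⊥
  from : Z ⊆ ⊥ → Z ∈ₗ trace F ⊥
  from Z⊆⊥ with family F | nonempty F
  ... | []    | ne = contradiction refl ne
  ... | A ∷ _ | _  = here (trans (⊆-antisym Z⊆⊥ (⊆-min Z)) (sym (∩-zeroʳ A)))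

vcDim-attained : (F : SetSystem n) → ∃ λ Y → Shatters F Y × ∣ Y ∣ ≡ vcDim F
vcDim-attained {n} F with argmax-sel id 0 (shatteredSizes F)
... | inj₁ eq = ⊥ , shatters-⊥ F , trans (∣⊥∣≡0 n) (sym eq)
... | inj₂ m∈ with (Y , Y∈ , eq) ← ∈-map⁻ ∣_∣ m∈
              with (_ , s) ← ∈-filter⁻ (shatters? F) {xs = subsets n} Y∈ = Y , s , sym eq

{-# OPTIONS --safe #-}

-- Both bounds come from deleting one element x of the ground set: if the family
-- P splits at x into the slices P₁ (sets containing x) and P₀ (the others), then
-- |P| = |P₁ ∪ P₀| + |P₁ ∩ P₀|, where P₁ ∪ P₀ is the projection of P and P₁ ∩ P₀
-- is nonempty iff P has an edge labelled x.
--
-- If P shatters no pair, P₁ ∩ P₀ has no essential element, so it has at most one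
-- member, and none when x is inessential: hence |P| ≤ |ess| + 1.
--
-- If P shatters Y, and every element of D, disjoint from Y, labels an edge, then
-- |P| ≥ 2^|Y| + |D|: an element outside Y is deleted, with P₁ ∩ P₀ paying for it
-- if it lies in D; for an element of Y both slices shatter the rest of Y and each
-- label in D survives in one of them. In a connected family every essential
-- element labels an edge, so |P| - |ess| ≥ 2^|Y| - |Y|, which is at least 5 once
-- |Y| ≥ 3.

module Submission where

open import Defs
open import Data.Nat using (ℕ; _≤_)
open import Data.Integer using (+_) renaming (_≤_ to _≤ᶻ_)
open import Data.Product using (_×_)
open import Relation.Binary.PropositionalEquality using (_≡_)

open import Algebra.Bundles using (AbelianGroup)
open import Algebra.Properties.Group using (//-rightDividesˡ)
open import Data.Bool using (Bool; true; false; not; if_then_else_)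
open import Data.Bool.Properties using (∧-zeroʳ; ∨-identityʳ; not-involutive; T-≡)
open import Data.Fin using (Fin; zero; suc; _≟_)
open import Data.Fin.Subset using (Subset; inside; outside; _∈_; _∉_; _⊆_; _∩_; _∪_; _─_; ⁅_⁆; ∣_∣; ⊥)
open import Data.Fin.Subset.Properties
  using (drop-there; ∉⊥; ∣⊥∣≡0; ∣⁅x⁆∣≡1; x∈⁅x⁆; x∈p∩q⁺; x∈p∩q⁻; p∩q⊆p; p∩q⊆q; p─q⊆p; ⊆-antisym; ∩-zeroʳ; ∪-identityʳ)
import Data.Integer as ℤ
import Data.Integer.Properties as ℤₚ
open import Data.List using (List; []; _∷_; length)
import Data.List.Membership.DecPropositional as DecMembership
open import Data.List.Membership.Propositional using () renaming (_∈_ to _∈ₗ_)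
open import Data.List.Membership.Propositional.Properties using (∈-map⁺; ∈-map⁻)
open import Data.List.Relation.Unary.All.Properties using (All¬⇒¬Any)
open import Data.List.Relation.Unary.AllPairs using (_∷_)
open import Data.List.Relation.Unary.Unique.Propositional using (Unique)
open import Data.Nat using (zero; suc; _+_; _*_; _^_; _<_; z≤n; s≤s)
import Data.Nat.Properties as ℕₚ
open import Data.Nat.Tactic.RingSolver using (solve-∀)
open import Data.Product using (∃; ∃₂; _,_; proj₁; proj₂)
open import Data.Sum using (_⊎_; inj₁; inj₂)
open import Data.Vec using ([]; _∷_; _[_]%=_; here; there)
open import Data.Vec.Properties
  using (∷-injectiveʳ; []=⇒lookup; lookup⇒[]=; lookup∘tabulate; updateAt-minimal; updateAt-updateAt; updateAt-id-local)
open import Function using (_∘_)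
open import Function.Bundles using (Equivalence)
open import Level using (0ℓ)
open import Relation.Binary.Construct.Closure.Symmetric using (fwd; bwd)
open import Relation.Binary.PropositionalEquality using (refl; sym; trans; cong; cong₂; subst; module ≡-Reasoning)
open import Relation.Nullary using (¬_; yes; no; does; contradiction)
open import Relation.Nullary.Decidable using (dec-true; dec-false; isYes≗does; toWitness)
open import Relation.Unary using (Pred; Decidable) renaming (_∪_ to _∪ₚ_; _∩_ to _∩ₚ_)
open import Relation.Unary.Properties using (_∪?_; _∩?_)

private
  variable
    n : ℕ
    P : Pred (Subset n) 0ℓ

-- Families as predicates

-- The element deleted is always the first one, so induction on `n` is deletion of one element after
-- another.
slice : Bool → Pred (Subset (suc n)) 0ℓ → Pred (Subset n) 0ℓ
slice b P A = P (b ∷ A)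

join meet : Pred (Subset (suc n)) 0ℓ → Pred (Subset n) 0ℓ
join P = slice inside P ∪ₚ slice outside P
meet P = slice inside P ∩ₚ slice outside P

slice? : ∀ b → Decidable P → Decidable (slice b P)
slice? b P? A = P? (b ∷ A)

join? : Decidable P → Decidable (join P)
join? P? = slice? inside P? ∪? slice? outside P?

meet? : Decidable P → Decidable (meet P)
meet? P? = slice? inside P? ∩? slice? outside P?

-- The cardinality of the family, found by running through the whole cube. Unlike the length of a
-- list, it needs no care about repetitions when slices are united.
count : {P : Pred (Subset n) 0ℓ} → Decidable P → ℕ
count {zero}  P? = if does (P? []) then 1 else 0
count {suc n} P? = count (slice? inside P?) + count (slice? outside P?)

count-cong : {P Q : Pred (Subset n) 0ℓ} (P? : Decidable P) (Q? : Decidable Q) →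
             (∀ A → does (P? A) ≡ does (Q? A)) → count P? ≡ count Q?
count-cong {zero}  P? Q? eq rewrite eq [] = refl
count-cong {suc n} P? Q? eq =
  cong₂ _+_ (count-cong (slice? inside P?) (slice? inside Q?) (eq ∘ (inside ∷_)))
            (count-cong (slice? outside P?) (slice? outside Q?) (eq ∘ (outside ∷_)))

-- Inclusion-exclusion, checked at each vertex of the cube and summed. As `count` is by definition
-- the sum over the two slices, applying this to them splits a count into those of `join` and
-- `meet`.
count-∪-∩ : {P Q : Pred (Subset n) 0ℓ} (P? : Decidable P) (Q? : Decidable Q) →
            count P? + count Q? ≡ count (P? ∪? Q?) + count (P? ∩? Q?)
count-∪-∩ {zero} P? Q? with does (P? []) | does (Q? [])
... | true  | true  = refl
... | true  | false = refl
... | false | true  = refl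
... | false | false = refl
count-∪-∩ {suc n} P? Q? = begin
  (p₁ + p₀) + (q₁ + q₀)  ≡⟨ exchange p₁ p₀ q₁ q₀ ⟩
  (p₁ + q₁) + (p₀ + q₀)  ≡⟨ cong₂ _+_ (count-∪-∩ P₁? Q₁?) (count-∪-∩ P₀? Q₀?) ⟩
  (u₁ + i₁) + (u₀ + i₀)  ≡⟨ exchange u₁ i₁ u₀ i₀ ⟩
  (u₁ + u₀) + (i₁ + i₀)  ∎
  where
  open ≡-Reasoning
  P₁? = slice? inside P?
  P₀? = slice? outside P?
  Q₁? = slice? inside Q?
  Q₀? = slice? outside Q?
  p₁ = count P₁?
  p₀ = count P₀?
  q₁ = count Q₁?
  q₀ = count Q₀?
  u₁ = count (P₁? ∪? Q₁?)
  u₀ = count (P₀? ∪? Q₀?)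
  i₁ = count (P₁? ∩? Q₁?)
  i₀ = count (P₀? ∩? Q₀?)
  exchange : ∀ a b c d → (a + b) + (c + d) ≡ (a + c) + (b + d)
  exchange = solve-∀

count-∅ : {P : Pred (Subset n) 0ℓ} (P? : Decidable P) → (∀ A → ¬ P A) → count P? ≡ 0
count-∅ {zero}  P? ¬P rewrite dec-false (P? []) (¬P []) = refl
count-∅ {suc n} P? ¬P = cong₂ _+_ (count-∅ (slice? inside P?) (¬P ∘ (inside ∷_)))
                                  (count-∅ (slice? outside P?) (¬P ∘ (outside ∷_)))

count-pos : {P : Pred (Subset n) 0ℓ} (P? : Decidable P) (A : Subset n) → P A → 1 ≤ count P?
count-pos P? []            p rewrite dec-true (P? []) p = ℕₚ.≤-refl
count-pos P? (inside  ∷ A) p = ℕₚ.m≤n⇒m≤n+o _ (count-pos (slice? inside P?) A p)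
count-pos P? (outside ∷ A) p = ℕₚ.m≤n⇒m≤o+n _ (count-pos (slice? outside P?) A p)

count-singleton : {P : Pred (Subset n) 0ℓ} (P? : Decidable P) (A : Subset n) →
                  P A → (∀ {B} → P B → B ≡ A) → count P? ≡ 1
count-singleton P? [] p _ rewrite dec-true (P? []) p = refl
count-singleton P? (inside ∷ A) p unique =
  cong₂ _+_ (count-singleton (slice? inside P?) A p (∷-injectiveʳ ∘ unique))
            (count-∅ (slice? outside P?) (λ _ q → contradiction (unique q) λ ()))
count-singleton P? (outside ∷ A) p unique =
  cong₂ _+_ (count-∅ (slice? inside P?) (λ _ q → contradiction (unique q) λ ()))
            (count-singleton (slice? outside P?) A p (∷-injectiveʳ ∘ unique))

module _ {n : ℕ} where
  open DecMembership (_≟ˢ_ {n}) using () renaming (_∈?_ to _∈ₗ?_)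

  count-list : (L : List (Subset n)) → Unique L → count (_∈ₗ? L) ≡ length L
  count-list []      _               = count-∅ (_∈ₗ? []) (λ _ ())
  count-list (A ∷ L) (A∉L ∷ unique) = begin
    -- Deciding membership in `A ∷ L` computes to the disjunction of the two Boolean answers, so
    -- `refl` suffices.
    count (_∈ₗ? (A ∷ L))            ≡⟨ count-cong (_∈ₗ? (A ∷ L)) (A? ∪? L?) (λ _ → refl) ⟩
    count (A? ∪? L?)                ≡⟨ ℕₚ.+-identityʳ _ ⟨
    count (A? ∪? L?) + 0            ≡⟨ cong (λ k → count (A? ∪? L?) + k) (count-∅ (A? ∩? L?) disjoint) ⟨
    count (A? ∪? L?) + count (A? ∩? L?)  ≡⟨ count-∪-∩ A? L? ⟨
    count A? + count L?             ≡⟨ cong₂ _+_ (count-singleton A? A refl (λ eq → eq)) (count-list L unique) ⟩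
    suc (length L)                  ∎
    where
    open ≡-Reasoning
    A? = _≟ˢ A
    L? = _∈ₗ? L
    disjoint : ∀ B → ¬ (B ≡ A × B ∈ₗ L)
    disjoint B (refl , B∈L) = All¬⇒¬Any A∉L B∈L

-- Shattering

-- `Z` ranges over all subsets and is cut down to `Y`, so that no side condition `Z ⊆ Y` has to be
-- carried through the inductions.
Shattered : Pred (Subset n) 0ℓ → Pred (Subset n) 0ℓ
Shattered P Y = ∀ Z → ∃ λ A → P A × A ∩ Y ≡ Z ∩ Y

shattered-join⁺ : {Y : Subset n} → Shattered P (outside ∷ Y) → Shattered (join P) Y
shattered-join⁺ s Z with s (inside ∷ Z)
... | inside  ∷ A , p , eq = A , inj₁ p , ∷-injectiveʳ eq
... | outside ∷ A , p , eq = A , inj₂ p , ∷-injectiveʳ eq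

shattered-join⁻ : {Y : Subset n} → Shattered (join P) Y → Shattered P (outside ∷ Y)
shattered-join⁻ s (z ∷ Z) with s Z
... | A , inj₁ p , eq = inside ∷ A  , p , cong₂ _∷_ (sym (∧-zeroʳ z)) eq
... | A , inj₂ p , eq = outside ∷ A , p , cong₂ _∷_ (sym (∧-zeroʳ z)) eq

-- A member of `meet P` extends to a member of `P` both with and without the new element, so either
-- value prescribed there can be met.
shattered-meet⁻ : {Y : Subset n} → Shattered (meet P) Y → Shattered P (inside ∷ Y)
shattered-meet⁻ s (z ∷ Z) with s Z
shattered-meet⁻ s (inside  ∷ Z) | A , (p , _) , eq = inside ∷ A  , p , cong (inside ∷_) eq
shattered-meet⁻ s (outside ∷ Z) | A , (_ , p) , eq = outside ∷ A , p , cong (outside ∷_) eq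

-- Prescribing `b` at the first element of the shattered set forces the witness into the slice of
-- `b`.
shattered-slice⁺ : ∀ b {Y : Subset n} → Shattered P (inside ∷ Y) → Shattered (slice b P) Y
shattered-slice⁺ b s Z with s (b ∷ Z)
shattered-slice⁺ inside  s Z | inside  ∷ A , p , eq = A , p , ∷-injectiveʳ eq
shattered-slice⁺ outside s Z | outside ∷ A , p , eq = A , p , ∷-injectiveʳ eq

∩-⊥-irrelevant : (A B : Subset n) → A ∩ ⊥ ≡ B ∩ ⊥
∩-⊥-irrelevant A B = trans (∩-zeroʳ A) (sym (∩-zeroʳ B))

shattered-⊥ : {A : Subset n} → P A → Shattered P ⊥
shattered-⊥ {A = A} p Z = A , p , ∩-⊥-irrelevant A Z

-- Essential elements enter as shattered singletons, so both hypotheses pass to `join` and `meet` by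
-- the lemmas above. Since `E` need only contain them, the step for `meet` can take `E` to be `⊥`.
count≤1+essential : {P : Pred (Subset n) 0ℓ} (P? : Decidable P) (E : Subset n) →
                    (∀ {x} → Shattered P ⁅ x ⁆ → x ∈ E) →
                    (∀ {Y} → Shattered P Y → ∣ Y ∣ ≤ 1) →
                    count P? ≤ suc ∣ E ∣
count≤1+essential {zero} P? [] _ _ with does (P? [])
... | true  = ℕₚ.≤-refl
... | false = z≤n
count≤1+essential {suc n} {P} P? (outside ∷ E) essential small = begin
  count P?                            ≡⟨ count-∪-∩ (slice? inside P?) (slice? outside P?) ⟩
  count (join? P?) + count (meet? P?)  ≡⟨ cong (λ k → count (join? P?) + k) (count-∅ (meet? P?) meet-empty) ⟩
  count (join? P?) + 0                ≡⟨ ℕₚ.+-identityʳ _ ⟩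
  count (join? P?)                    ≤⟨ count≤1+essential (join? P?) E
                                           (drop-there ∘ essential ∘ shattered-join⁻) (small ∘ shattered-join⁻) ⟩
  suc ∣ E ∣                           ∎
  where
  open ℕₚ.≤-Reasoning
  meet-empty : ∀ A → ¬ meet P A
  -- A common member of the slices would make `P` shatter `⁅ zero ⁆`, but `zero` is not in
  -- `outside ∷ E`.
  meet-empty A p with () ← essential {zero} (shattered-meet⁻ (shattered-⊥ p))
count≤1+essential {suc n} {P} P? (inside ∷ E) essential small = begin
  count P?                            ≡⟨ count-∪-∩ (slice? inside P?) (slice? outside P?) ⟩
  count (join? P?) + count (meet? P?)  ≤⟨ ℕₚ.+-mono-≤
                                           (count≤1+essential (join? P?) E
                                             (drop-there ∘ essential ∘ shattered-join⁻) (small ∘ shattered-join⁻))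
                                           (count≤1+essential (meet? P?) ⊥ meet-inessential meet-small) ⟩
  (suc ∣ E ∣) + (suc ∣ ⊥ {n} ∣)       ≡⟨ cong (λ k → (suc ∣ E ∣) + (suc k)) (∣⊥∣≡0 n) ⟩
  suc ∣ E ∣ + 1                       ≡⟨ ℕₚ.+-comm (suc ∣ E ∣) 1 ⟩
  suc (suc ∣ E ∣)                     ∎
  where
  open ℕₚ.≤-Reasoning
  meet-inessential : ∀ {x} → Shattered (meet P) ⁅ x ⁆ → x ∈ ⊥
  -- A singleton shattered by `meet P`, together with the deleted element, would be a pair shattered
  -- by `P`.
  meet-inessential {x} s = contradiction (subst (λ k → suc k ≤ 1) (∣⁅x⁆∣≡1 x) (small (shattered-meet⁻ s))) λ { (s≤s ()) }
  meet-small : ∀ {Y} → Shattered (meet P) Y → ∣ Y ∣ ≤ 1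
  meet-small s = ℕₚ.<⇒≤ (small (shattered-meet⁻ s))

-- Edge labels

-- Flipping `x`, rather than inserting it, forgets the direction of the edge.
HasEdge : Pred (Subset n) 0ℓ → Fin n → Set
HasEdge P x = ∃ λ A → P A × P (A [ x ]%= not)

hasEdge-zero : HasEdge P zero → ∃ (meet P)
hasEdge-zero (inside  ∷ A , p , q) = A , p , q
hasEdge-zero (outside ∷ A , p , q) = A , q , p

hasEdge-slice : ∀ {x} → HasEdge P (suc x) → HasEdge (slice inside P) x ⊎ HasEdge (slice outside P) x
hasEdge-slice (inside  ∷ A , p , q) = inj₁ (A , p , q)
hasEdge-slice (outside ∷ A , p , q) = inj₂ (A , p , q)

hasEdge-join : ∀ {x} → HasEdge P (suc x) → HasEdge (join P) x
hasEdge-join (inside  ∷ A , p , q) = A , inj₁ p , inj₁ q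
hasEdge-join (outside ∷ A , p , q) = A , inj₂ p , inj₂ q

-- Distributes labels between two slices. A label that survives in both is assigned to one of them,
-- so that the sizes add up exactly.
partition : {Q R : Pred (Fin n) 0ℓ} (D : Subset n) → (∀ {x} → x ∈ D → Q x ⊎ R x) →
            ∃₂ λ D₁ D₂ → (∀ {x} → x ∈ D₁ → x ∈ D × Q x) × (∀ {x} → x ∈ D₂ → x ∈ D × R x) ×
                         ∣ D ∣ ≡ ∣ D₁ ∣ + ∣ D₂ ∣
partition []      _ = [] , [] , (λ ()) , (λ ()) , refl
partition (outside ∷ D) split
  with D₁ , D₂ , q , r , eq ← partition D (split ∘ there)
  = outside ∷ D₁ , outside ∷ D₂
  , (λ { (there x∈) → there (proj₁ (q x∈)) , proj₂ (q x∈) })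
  , (λ { (there x∈) → there (proj₁ (r x∈)) , proj₂ (r x∈) })
  , eq
partition (inside ∷ D) split
  with split here | partition D (split ∘ there)
... | inj₁ q₀ | D₁ , D₂ , q , r , eq
  = inside ∷ D₁ , outside ∷ D₂
  , (λ { here → here , q₀ ; (there x∈) → there (proj₁ (q x∈)) , proj₂ (q x∈) })
  , (λ { (there x∈) → there (proj₁ (r x∈)) , proj₂ (r x∈) })
  , cong suc eq
... | inj₂ r₀ | D₁ , D₂ , q , r , eq
  = outside ∷ D₁ , inside ∷ D₂
  , (λ { (there x∈) → there (proj₁ (q x∈)) , proj₂ (q x∈) })
  , (λ { here → here , r₀ ; (there x∈) → there (proj₁ (r x∈)) , proj₂ (r x∈) })
  , trans (cong suc eq) (sym (ℕₚ.+-suc ∣ D₁ ∣ ∣ D₂ ∣))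

-- `D` is any set of labels, not the set of all of them: after an element of `Y` is deleted, each
-- slice is charged only for its own share of `D`.
2^+labels≤count : {P : Pred (Subset n) 0ℓ} (P? : Decidable P) (Y D : Subset n) → Shattered P Y →
                  (∀ {x} → x ∈ D → x ∉ Y × HasEdge P x) →
                  2 ^ ∣ Y ∣ + ∣ D ∣ ≤ count P?
2^+labels≤count P? [] [] s _ with [] , p , _ ← s [] = count-pos P? [] p
2^+labels≤count P? (inside ∷ Y) (inside ∷ D) s label = contradiction here (proj₁ (label here))
2^+labels≤count {P = P} P? (inside ∷ Y) (outside ∷ D) s label
  with D₁ , D₀ , l₁ , l₀ , eq ← partition D (hasEdge-slice ∘ proj₂ ∘ label ∘ there) = begin
  2 * k + ∣ D ∣                ≡⟨ cong (λ m → 2 * k + m) eq ⟩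
  2 * k + (d₁ + d₀)            ≡⟨ double k d₁ d₀ ⟩
  (k + d₁) + (k + d₀)          ≤⟨ ℕₚ.+-mono-≤
    (2^+labels≤count (slice? inside P?) Y D₁ (shattered-slice⁺ inside s) (disjoint l₁))
    (2^+labels≤count (slice? outside P?) Y D₀ (shattered-slice⁺ outside s) (disjoint l₀)) ⟩
  count P?                     ∎
  where
  open ℕₚ.≤-Reasoning
  k  = 2 ^ ∣ Y ∣
  d₁ = ∣ D₁ ∣
  d₀ = ∣ D₀ ∣
  double : ∀ a b c → 2 * a + (b + c) ≡ (a + b) + (a + c)
  double = solve-∀
  disjoint : ∀ {D′} {Q : Pred (Fin _) 0ℓ} → (∀ {x} → x ∈ D′ → x ∈ D × Q x) →
             ∀ {x} → x ∈ D′ → x ∉ Y × Q x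
  disjoint l x∈ = proj₁ (label (there (proj₁ (l x∈)))) ∘ there , proj₂ (l x∈)
2^+labels≤count P? (outside ∷ Y) (d ∷ D) s label = begin
  2 ^ ∣ Y ∣ + ∣ d ∷ D ∣                 ≤⟨ ℕₚ.+-monoʳ-≤ (2 ^ ∣ Y ∣) (head-label d (proj₂ ∘ label)) ⟩
  2 ^ ∣ Y ∣ + (∣ D ∣ + count (meet? P?))  ≡⟨ ℕₚ.+-assoc (2 ^ ∣ Y ∣) ∣ D ∣ _ ⟨
  2 ^ ∣ Y ∣ + ∣ D ∣ + count (meet? P?)    ≤⟨ ℕₚ.+-monoˡ-≤ _ (2^+labels≤count (join? P?) Y D (shattered-join⁺ s)
                                             (λ x∈ → proj₁ (label (there x∈)) ∘ there
                                                   , hasEdge-join (proj₂ (label (there x∈))))) ⟩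
  count (join? P?) + count (meet? P?)    ≡⟨ count-∪-∩ (slice? inside P?) (slice? outside P?) ⟨
  count P?                              ∎
  where
  open ℕₚ.≤-Reasoning
  head-label : ∀ d → (zero ∈ d ∷ D → HasEdge _ zero) → ∣ d ∷ D ∣ ≤ ∣ D ∣ + count (meet? P?)
  head-label outside _ = ℕₚ.m≤m+n _ _
  head-label inside  h with A , p ← hasEdge-zero (h here) =
    subst (_≤ ∣ D ∣ + count (meet? P?)) (ℕₚ.+-comm ∣ D ∣ 1) (ℕₚ.+-monoʳ-≤ ∣ D ∣ (count-pos (meet? P?) A p))

-- Set systems

module _ {n : ℕ} (F : SetSystem n) where
  open DecMembership (_≟ˢ_ {n}) using () renaming (_∈?_ to _∈ₗ?_)

  member? : Decidable (_∈ˢ F)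
  member? = _∈ₗ? family F

  count-member : count member? ≡ card F
  count-member = count-list (family F) (distinct F)

  shattered⇒shatters : ∀ {Y} → Shattered (_∈ˢ F) Y → Shatters F Y
  shattered⇒shatters {Y} s Z = to , from
    where
    to : Z ∈ₗ trace F Y → Z ⊆ Y
    to Z∈ with A , _ , refl ← ∈-map⁻ (_∩ Y) Z∈ = p∩q⊆q A Y
    from : Z ⊆ Y → Z ∈ₗ trace F Y
    from Z⊆Y with A , A∈F , eq ← s Z =
      subst (_∈ₗ trace F Y)
            (trans eq (⊆-antisym (p∩q⊆p Z Y) (λ x∈Z → x∈p∩q⁺ (x∈Z , Z⊆Y x∈Z))))
            (∈-map⁺ (_∩ Y) A∈F)

  shatters⇒shattered : ∀ {Y} → Shatters F Y → Shattered (_∈ˢ F) Y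
  shatters⇒shattered {Y} s Z
    with A , A∈F , eq ← ∈-map⁻ (_∩ Y) (proj₂ (s (Z ∩ Y)) (p∩q⊆q Z Y)) = A , A∈F , sym eq

  essential⇒∈ess : ∀ {x} → Essential F x → x ∈ ess F
  essential⇒∈ess {x} e =
    lookup⇒[]= x (ess F) (trans (lookup∘tabulate _ x) (dec-true (essential? F x) e))

  ∈ess⇒essential : ∀ {x} → x ∈ ess F → Essential F x
  ∈ess⇒essential {x} x∈ = toWitness {a? = essential? F x} (Equivalence.from T-≡
    (trans (isYes≗does (essential? F x)) (trans (sym (lookup∘tabulate _ x)) ([]=⇒lookup x∈))))

  shattered⁅x⁆⇒essential : ∀ {x} → Shattered (_∈ˢ F) ⁅ x ⁆ → Essential F x
  shattered⁅x⁆⇒essential {x} s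
    -- The traces `⁅ x ⁆` and `⊥` provide a set with `x` and a set without it.
    with A , A∈F , A∩x ← s ⁅ x ⁆ | B , B∈F , B∩x ← s ⊥ =
    A , B , A∈F , B∈F , x∈A , x∉B
    where
    x∈A : x ∈ A
    x∈A = proj₁ (x∈p∩q⁻ A ⁅ x ⁆ (subst (x ∈_) (sym A∩x) (x∈p∩q⁺ (x∈⁅x⁆ x , x∈⁅x⁆ x))))
    x∉B : x ∉ B
    x∉B x∈B = ∉⊥ (proj₁ (x∈p∩q⁻ ⊥ ⁅ x ⁆ (subst (x ∈_) B∩x (x∈p∩q⁺ (x∈B , x∈⁅x⁆ x)))))

  vcDim≤1⇒card≤1+ess : vcDim F ≤ 1 → card F ≤ suc ∣ ess F ∣
  vcDim≤1⇒card≤1+ess vc≤1 = subst (_≤ suc ∣ ess F ∣) count-member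
    (count≤1+essential member? (ess F) (essential⇒∈ess ∘ shattered⁅x⁆⇒essential)
      (λ {Y} s → ℕₚ.≤-trans (vcDim-upper F Y (shattered⇒shatters s)) vc≤1))

-- Walks in the one-inclusion graph

∪⁅x⁆≡flip : ∀ {x} (A : Subset n) → x ∉ A → A ∪ ⁅ x ⁆ ≡ A [ x ]%= not
∪⁅x⁆≡flip {x = zero}  (inside  ∷ A) x∉A = contradiction here x∉A
∪⁅x⁆≡flip {x = zero}  (outside ∷ A) x∉A = cong (inside ∷_) (∪-identityʳ A)
∪⁅x⁆≡flip {x = suc x} (a ∷ A)       x∉A = cong₂ _∷_ (∨-identityʳ a) (∪⁅x⁆≡flip A (x∉A ∘ there))

module _ {n : ℕ} (F : SetSystem n) where

  adjacent⇒flip : ∀ {A B} → Adjacent F A B → ∃ λ b → A ∈ˢ F × B ∈ˢ F × B ≡ A [ b ]%= not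
  adjacent⇒flip {A} (fwd (b , e)) = b , source∈ , target∈ , trans target≡ (∪⁅x⁆≡flip A label∉)
    where open Edge e
  -- Flipping is an involution, so an edge traversed backwards is again a flip at its label.
  adjacent⇒flip {A} {B} (bwd (b , e)) = b , target∈ , source∈ , (begin
    B                              ≡⟨ updateAt-id-local b B (not-involutive _) ⟨
    B [ b ]%= (not ∘ not)          ≡⟨ updateAt-updateAt b B ⟨
    (B [ b ]%= not) [ b ]%= not    ≡⟨ cong (_[ b ]%= not) (trans target≡ (∪⁅x⁆≡flip B label∉)) ⟨
    A [ b ]%= not                  ∎)
    where
    open Edge e
    open ≡-Reasoning

  -- Steps with other labels leave `x` in the set, so the step at which `x` is lost must be labelled
  -- `x`.
  walk⇒hasEdge : ∀ {A B k x} → Walk F A B k → x ∈ A → x ∉ B → HasEdge (_∈ˢ F) x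
  walk⇒hasEdge (stop _) x∈A x∉A = contradiction x∈A x∉A
  walk⇒hasEdge {A} {x = x} (step adj walk) x∈A x∉B
    with b , A∈F , C∈F , refl ← adjacent⇒flip adj
    with x ≟ b
  ... | yes refl = A , A∈F , C∈F
  ... | no x≢b   = walk⇒hasEdge walk (updateAt-minimal x b A x≢b x∈A) x∉B

  wellGraded⇒hasEdge : WellGraded F → ∀ {x} → Essential F x → HasEdge (_∈ˢ F) x
  wellGraded⇒hasEdge wg (A , B , A∈F , B∈F , x∈A , x∉B) =
    walk⇒hasEdge (proj₁ (wg A∈F B∈F)) x∈A x∉B

-- Size of a well-graded family

∣p∣≤∣p─q∣+∣q∣ : (p q : Subset n) → ∣ p ∣ ≤ ∣ p ─ q ∣ + ∣ q ∣
∣p∣≤∣p─q∣+∣q∣ []            []            = z≤n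
∣p∣≤∣p─q∣+∣q∣ (outside ∷ p) (outside ∷ q) = ∣p∣≤∣p─q∣+∣q∣ p q
∣p∣≤∣p─q∣+∣q∣ (inside  ∷ p) (outside ∷ q) = s≤s (∣p∣≤∣p─q∣+∣q∣ p q)
∣p∣≤∣p─q∣+∣q∣ (x       ∷ p) (inside  ∷ q) = begin
  ∣ x ∷ p ∣               ≤⟨ ∣x∷p∣≤1+∣p∣ x ⟩
  suc ∣ p ∣               ≤⟨ s≤s (∣p∣≤∣p─q∣+∣q∣ p q) ⟩
  suc (∣ p ─ q ∣ + ∣ q ∣)  ≡⟨ ℕₚ.+-suc ∣ p ─ q ∣ ∣ q ∣ ⟨
  ∣ p ─ q ∣ + (suc ∣ q ∣)  ∎
  where
  open ℕₚ.≤-Reasoning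
  ∣x∷p∣≤1+∣p∣ : ∀ x → ∣ x ∷ p ∣ ≤ suc ∣ p ∣
  ∣x∷p∣≤1+∣p∣ inside  = ℕₚ.≤-refl
  ∣x∷p∣≤1+∣p∣ outside = ℕₚ.n≤1+n _

x∈p─q⇒x∉q : ∀ {x} (p q : Subset n) → x ∈ p ─ q → x ∉ q
x∈p─q⇒x∉q (_ ∷ p) (_ ∷ q) (there x∈) (there x∈q) = x∈p─q⇒x∉q p q x∈ x∈q
x∈p─q⇒x∉q (inside  ∷ p) (inside ∷ q) () here
x∈p─q⇒x∉q (outside ∷ p) (inside ∷ q) () here

-- The labels are the essential elements outside `Y`. Removing `Y` costs at most `∣ Y ∣` of them,
-- which is the term added on the right.
wellGraded⇒2^+ess≤card+size : (F : SetSystem n) → WellGraded F → ∀ Y → Shatters F Y →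
                              2 ^ ∣ Y ∣ + ∣ ess F ∣ ≤ card F + ∣ Y ∣
wellGraded⇒2^+ess≤card+size F wg Y s = begin
  2 ^ ∣ Y ∣ + ∣ ess F ∣                ≤⟨ ℕₚ.+-monoʳ-≤ (2 ^ ∣ Y ∣) (∣p∣≤∣p─q∣+∣q∣ (ess F) Y) ⟩
  2 ^ ∣ Y ∣ + (∣ ess F ─ Y ∣ + ∣ Y ∣)  ≡⟨ ℕₚ.+-assoc (2 ^ ∣ Y ∣) _ _ ⟨
  2 ^ ∣ Y ∣ + ∣ ess F ─ Y ∣ + ∣ Y ∣    ≤⟨ ℕₚ.+-monoˡ-≤ ∣ Y ∣
    (2^+labels≤count (member? F) Y (ess F ─ Y) (shatters⇒shattered F s) label) ⟩
  count (member? F) + ∣ Y ∣            ≡⟨ cong (λ k → k + ∣ Y ∣) (count-member F) ⟩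
  card F + ∣ Y ∣                       ∎
  where
  open ℕₚ.≤-Reasoning
  label : ∀ {x} → x ∈ ess F ─ Y → x ∉ Y × HasEdge (_∈ˢ F) x
  label x∈ = x∈p─q⇒x∉q (ess F) Y x∈
           , wellGraded⇒hasEdge F wg (∈ess⇒essential F (p─q⊆p (ess F) Y x∈))

-- Additionality and VC-dimension

5+j<2^[3+j] : ∀ j → 5 + j < 2 ^ (3 + j)
5+j<2^[3+j] zero    = ℕₚ.m≤m+n 6 2
-- Of the two copies of the smaller power, one is at least `1` and covers the growth of the left
-- side; the other takes the induction hypothesis.
5+j<2^[3+j] (suc j) = ℕₚ.+-mono-≤ {1} (ℕₚ.m^n>0 2 (3 + j))
  (ℕₚ.≤-trans (5+j<2^[3+j] j) (ℕₚ.≤-reflexive (sym (ℕₚ.+-identityʳ _))))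

-- For a shattered set of size `k` in a well-graded family of additionality 2, the size bound
-- becomes this hypothesis. It fails from `k = 3` on, where 8 exceeds 5.
2^k≤2+k⇒k≤2 : ∀ k → 2 ^ k ≤ 2 + k → k ≤ 2
2^k≤2+k⇒k≤2 0 _ = z≤n
2^k≤2+k⇒k≤2 1 _ = s≤s z≤n
2^k≤2+k⇒k≤2 2 _ = ℕₚ.≤-refl
2^k≤2+k⇒k≤2 (suc (suc (suc j))) le = contradiction le (ℕₚ.<⇒≱ (5+j<2^[3+j] j))

additionality≤1 : (F : SetSystem n) → vcDim F ≤ 1 → additionality F ≤ᶻ + 1
additionality≤1 F vc≤1 = begin
  additionality F            ≡⟨ ℤₚ.[+m]-[+n]≡m⊖n (card F) e ⟩
  card F ℤ.⊖ e               ≤⟨ ℤₚ.⊖-monoˡ-≤ e (vcDim≤1⇒card≤1+ess F vc≤1) ⟩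
  -- Writing the terms as `e + 1` and `e + 0` lets `e` cancel, and `1 ℤ.⊖ 0` computes to `+ 1`.
  suc e ℤ.⊖ e                ≡⟨ cong₂ ℤ._⊖_ (ℕₚ.+-comm 1 e) (sym (ℕₚ.+-identityʳ e)) ⟩
  (e + 1) ℤ.⊖ (e + 0)        ≡⟨ ℤₚ.+-cancelˡ-⊖ e 1 0 ⟩
  + 1                        ∎
  where
  open ℤₚ.≤-Reasoning
  e = ∣ ess F ∣

2≤vcDim : (F : SetSystem n) → additionality F ≡ + 2 → 2 ≤ vcDim F
2≤vcDim F add≡2 = ℕₚ.≰⇒> λ vc≤1 →
  contradiction (subst (_≤ᶻ + 1) add≡2 (additionality≤1 F vc≤1)) λ { (ℤ.+≤+ (s≤s ())) }

card≡2+ess : (F : SetSystem n) → additionality F ≡ + 2 → card F ≡ 2 + ∣ ess F ∣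
card≡2+ess F add≡2 = ℤₚ.+-injective (begin
  + card F                                ≡⟨ //-rightDividesˡ (AbelianGroup.group ℤₚ.+-0-abelianGroup) (+ ∣ ess F ∣) (+ card F) ⟨
  additionality F ℤ.+ + ∣ ess F ∣         ≡⟨ cong (ℤ._+ + ∣ ess F ∣) add≡2 ⟩
  + 2 ℤ.+ + ∣ ess F ∣                     ∎)
  where open ≡-Reasoning

vcDim≤2 : (F : SetSystem n) → WellGraded F → additionality F ≡ + 2 → vcDim F ≤ 2
vcDim≤2 F wg add≡2 with Y , s , size ← vcDim-attained F =
  subst (_≤ 2) size (2^k≤2+k⇒k≤2 ∣ Y ∣ (ℕₚ.+-cancelʳ-≤ ∣ ess F ∣ _ _ (begin
    2 ^ ∣ Y ∣ + ∣ ess F ∣      ≤⟨ wellGraded⇒2^+ess≤card+size F wg Y s ⟩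
    card F + ∣ Y ∣             ≡⟨ cong (λ k → k + ∣ Y ∣) (card≡2+ess F add≡2) ⟩
    2 + ∣ ess F ∣ + ∣ Y ∣      ≡⟨ cong (λ k → 2 + k) (ℕₚ.+-comm ∣ ess F ∣ ∣ Y ∣) ⟩
    2 + ∣ Y ∣ + ∣ ess F ∣      ∎)))
  where open ℕₚ.≤-Reasoning

mainTheorem7 : ( (∀ (n : ℕ) (F : SetSystem n) → vcDim F ≤ 1 → additionality F ≤ᶻ + 1)
    × (∀ (n : ℕ) (F : SetSystem n) → additionality F ≡ + 2 → 2 ≤ vcDim F) )
    × (∀ (n : ℕ) (F : SetSystem n) → WellGraded F → additionality F ≡ + 2 → vcDim F ≡ 2)
mainTheorem7 = ((λ _ → additionality≤1) , (λ _ → 2≤vcDim))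
             , λ _ F wg add≡2 → ℕₚ.≤-antisym (vcDim≤2 F wg add≡2) (2≤vcDim F add≡2)
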